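{- Let $G$ be an incrementally-bound recursion scheme of order $n$. Let $CPDA(G)$ be the associated order-$n$ collapsible pushdown automaton, and let $PDA(G)$ be the order-$n$ pushdown automaton obtained from $CPDA(G)$ by replacing every $collapse$ operation (performed on a stack $s$) by $pop_1$ if $top_1\,s$ is a prime lambda node, and by $pop_{n-\mathrm{ord}(top_1 s)+1}$ otherwise. Then $PDA(G)$ and $CPDA(G)$ are equivalent, i.e. they generate the same tree.
   Context: **Types and recursion schemes.** Simple types are built from one atom $o$; $\mathrm{ord}(o)=0$, $\mathrm{ord}(A\to B)=\max(\mathrm{ord}(A)+1,\mathrm{ord}(B))$. A recursion scheme $G=\langle\Sigma,\mathcal N,\mathcal R,S\rangle$ has terminals $\Sigma$ (types $o\to\dots\to o$), finitely many typed nonterminals $\mathcal N$, a start symbol $S:o$, and for each nonterminal $F:A_1\to\dots\to A_m\to o$ one rule $Fz_1\dots z_m\to e$, with $e$ a ground-type applicative term over $\Sigma\cup\mathcal N\cup\{z_i:A_i\}$. Its order $n$ is the highest order of a nonterminal. **Computation tree/graph.** Put $\Lambda(F)=\lambda z_1\dots z_m.e$. Take $\eta$-long normal forms (every subterm in operand position is $\eta$-expanded and written $\lambda\overline x.t$ with $t$ of ground type; at ground type the prefix is a dummy lambda "$\lambda.$"). The computation tree alternates lambda nodes $\lambda\overline x$ (one node for the whole prefix), each with a single child $E_1$, with nodes of the following kinds: (i) a variable or terminal $z$ with arguments $s_1,\dots,s_m$, whose children $E_1,\dots,E_m$ are the trees of the $s_i$; (ii) an application node $@$, for $F s_1\dots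 s_m$ with $F\in\mathcal N$, $m\ge1$, whose children are $E_0$ = the tree of $\Lambda(F)$ and $E_1,\dots,E_m$ = the trees of the $s_i$. A ground-type nonterminal is replaced by the body of its rule. Unfolding from $\Lambda(S)$ gives the (possibly infinite) computation tree. Letting references to nonterminals point back to the root of the single copy of the tree of $\Lambda(F)$ gives the finite computation graph, with node set $N$. $E_i(u)$ is the $i$-th child of $u$. A lambda node is prime if it is the child $E_0$ of an $@$-node. The order of a variable node is that of its type; $\mathrm{ord}(\lambda x_1\dots x_k)=1+\max_i\mathrm{ord}(x_i)$ for $k>0$, and $0$ for a dummy lambda. The span of a variable node is its distance to its binder (the lambda node binding it), i.e. the $p$ such that $pop_1^p$ brings the binder to the top. $G$ is incrementally-bound if every (bound) variable node $x$ in every finite unfolding of its computation tree is bound by the first lambda node, on the path from it to the root, of order strictly greater than $\mathrm{ord}(x)$ (terminals and nonterminals are constants). **Stacks with links.** An order-1 stack is a finite sequence of symbols $a^{(j,k)}$, $a\in N$, with link of order $j$ and height $k$; an order-$(m+1)$ stack is a sequence of order-$m$ stacks, last element on top; $\bot_1$ is the empty sequence, $\bot_{m+1}=[\bot_m]$. $push_1^{a,j}$ appends $a^{(j,1)}$ to the top order-1 stack; $push_1^{a}$ appends $a$ with an irrelevant link. $pop_j$ removes the top order-$(j-1)$ stack; $top_1$ is the top symbol. $s^{\langle j\rangle}$ replaces every link $(j,k)$ in $s$ by $(j,k+1)$. For $j\ge2$, $push_j[s_1\dots s_r]=[s_1\dots s_r\,s_r^{\langle j\rangle}]$ if $j$ is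 the order of the stack, and $[s_1\dots s_{r-1}\,push_j s_r]$ if $j$ is smaller. $collapse\,s=pop_j^k s$ if $top_1s$ carries link $(j,k)$. For an ordinary pushdown automaton the links are ignored and there is no collapse. **$CPDA(G)$.** Stack alphabet $N$; initial configuration $push_1^{\lambda}\bot_n$, $\lambda$ being the root dummy lambda node. With $u$ the top symbol, it performs ($;$ is left-to-right sequencing, $top_1$ is evaluated on the current stack): - (A) $u=@$: $push_1^{E_0(u),1}$. - (S) $u$ a terminal $f$: output $f$; in the $i$-th branch ($1\le i\le\mathrm{arity}(f)$) do $push_1^{E_i(u)}$. - (L) $u$ a lambda node: $push_1^{E_1(u)}$. - ($V_1$) $u$ a variable of order $l\ge1$, the $i$-th parameter of its binder, with span $p$: $push_{n-l+1};pop_1^p;collapse;push_1^{E_i(top_1),\,n-l+1}$. - ($V_0$) $u$ a ground-type variable, the $i$-th parameter of its binder, with span $p$: $pop_1^p;collapse;push_1^{E_i(top_1)}$. The generated tree consists of the outputs of (S), branch $i$ giving the $i$-th subtree. -}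

module Defs where

open import Data.Bool using (if_then_else_)
open import Data.Fin using (Fin; toℕ)
open import Data.List using (List; []; _∷_; map; foldr; allFin)
open import Data.List.Membership.Propositional using (_∈_)
open import Data.List.Relation.Unary.All as All using (All; []; _∷_)
open import Data.List.Relation.Unary.Any using (Any; here; there; index)
open import Data.Maybe as Maybe using (Maybe; just; nothing; _>>=_)
open import Data.Nat using (ℕ; zero; suc; _+_; _∸_; _⊔_; _≤_; _<_; _≟_; NonZero)
open import Data.Product using (_×_; _,_; proj₁; ∃-syntax)
open import Function using (_∘_)
open import Level using (0ℓ)
open import Relation.Binary using (Rel)
open import Relation.Binary.Construct.Closure.ReflexiveTransitive using (Star)
open import Relation.Binary.Construct.Composition renaming (_;_ to _⨾_)
open import Relation.Binary.PropositionalEquality using (_≡_; refl)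
open import Relation.Nullary using (¬_; does)

infixr 5 _⇒_

------------------------------------------------------------------------
-- Types and recursion schemes

data Ty : Set where
  o   : Ty
  _⇒_ : Ty → Ty → Ty

data Arrow : Ty → Set where
  arrow : ∀ {A B} → Arrow (A ⇒ B)

ord : Ty → ℕ
ord o       = 0
ord (A ⇒ B) = suc (ord A) ⊔ ord B

args : Ty → List Ty
args o       = []
args (A ⇒ B) = A ∷ args B

maximum : List ℕ → ℕ
maximum = foldr _⊔_ 0

first-order : ℕ → Ty
first-order zero    = o
first-order (suc k) = o ⇒ first-order k

record Signature : Set₁ where
  field
    Terminal : Set
    arity    : Terminal → ℕ
    size     : ℕ
    type     : Fin size → Ty

  Nonterminal : Set
  Nonterminal = Fin size

module _ (Sig : Signature) where
  open Signature Sig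

  infixl 6 _·_

  data Term (Δ : List Ty) : Ty → Set where
    var : ∀ {A} → A ∈ Δ → Term Δ A
    con : (f : Terminal) → Term Δ (first-order (arity f))
    nt  : (F : Nonterminal) → Term Δ (type F)
    _·_ : ∀ {A B} → Term Δ (A ⇒ B) → Term Δ A → Term Δ B

record Scheme : Set₁ where
  field
    signature : Signature
  open Signature signature public
  field
    rhs          : (F : Nonterminal) → Term signature (args (type F)) o
    start        : Nonterminal
    start-ground : type start ≡ o

order : Scheme → ℕ
order G = maximum (map (ord ∘ type) (allFin size))
  where open Scheme G

------------------------------------------------------------------------
-- η-long forms

-- A context has one frame per enclosing lambda node, the innermost first,
-- so a variable is a choice of a binder and of one of its parameters.
Context : Set
Context = List (List Ty)

Var : Context → Ty → Set
Var Γ A = Any (A ∈_) Γ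

module _ (Sig : Signature) where
  open Signature Sig

  infix 4 _⟨_⟩

  data Head (Γ : Context) : Ty → Set where
    var : ∀ {A} → Var Γ A → Head Γ A
    con : (f : Terminal) → Head Γ (first-order (arity f))
    nt  : (F : Nonterminal) → Head Γ (type F)

  mutual
    data Lam (Γ : Context) (A : Ty) : Set where
      lam : Body (args A ∷ Γ) → Lam Γ A

    data Body (Γ : Context) : Set where
      _⟨_⟩ : ∀ {A} → Head Γ A → All (Lam Γ) (args A) → Body Γ

module _ {Sig : Signature} where

  mutual
    η-var : ∀ {Γ} A → Var Γ A → Lam Sig Γ A
    η-var A x = lam (var (there x) ⟨ η-vars A here ⟩)

    η-vars : ∀ {Γ} A → (∀ {B} → B ∈ args A → Var Γ B) → All (Lam Sig Γ) (args A)
    η-vars o       ρ = []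
    η-vars (A ⇒ B) ρ = η-var A (ρ (here refl)) ∷ η-vars B (ρ ∘ there)

  -- η-lam is the η-long form of a term in operand position; η-body that of a
  -- ground-type application whose remaining arguments, already in η-long form,
  -- are ss. The map ρ embeds the parameters of the rule into the context.
  mutual
    η-lam : ∀ {Δ Γ} A → (∀ {B} → B ∈ Δ → Var Γ B) → Term Sig Δ A → Lam Sig Γ A
    η-lam A ρ t = lam (η-body (there ∘ ρ) t (η-vars A here))

    η-body : ∀ {Δ Γ A} → (∀ {B} → B ∈ Δ → Var Γ B) →
             Term Sig Δ A → All (Lam Sig Γ) (args A) → Body Sig Γ
    η-body ρ (var x) ss = var (ρ x) ⟨ ss ⟩
    η-body ρ (con f) ss = con f ⟨ ss ⟩
    η-body ρ (nt F)  ss = nt F ⟨ ss ⟩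
    η-body ρ (_·_ {A} t s) ss = η-body ρ t (η-lam A ρ s ∷ ss)

------------------------------------------------------------------------
-- The computation graph

module Graph (G : Scheme) where
  open Scheme G

  Λ : (F : Nonterminal) → Lam signature [] (type F)
  Λ F = lam (η-body here (rhs F) [])

  -- Occurrences (paths from the root) of subterms in the terms Λ F.
  mutual
    data LamOcc : ∀ {Γ A} → Lam signature Γ A → Set where
      root : (F : Nonterminal) → LamOcc (Λ F)
      arg  : ∀ {Γ A B} {h : Head signature Γ A} {ss : All (Lam signature Γ) (args A)} →
             BodyOcc (h ⟨ ss ⟩) → (i : B ∈ args A) → LamOcc (All.lookup ss i)

    data BodyOcc : ∀ {Γ} → Body signature Γ → Set where
      body : ∀ {Γ A} {b : Body signature (args A ∷ Γ)} → LamOcc (lam {A = A} b) → BodyOcc b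

  data Kind : ∀ {Γ} → Body signature Γ → Set where
    variable-node : ∀ {Γ A} {x : Var Γ A} {ss} → Kind (var x ⟨ ss ⟩)
    terminal-node : ∀ {Γ f} {ss : All (Lam signature Γ) _} → Kind (con f ⟨ ss ⟩)
    app-node      : ∀ {Γ F} {ss : All (Lam signature Γ) _} → Arrow (type F) → Kind (nt F ⟨ ss ⟩)

  data Node : Set where
    lam : ∀ {Γ A} {t : Lam signature Γ A} → LamOcc t → Node
    op  : ∀ {Γ} {b : Body signature Γ} → BodyOcc b → Kind b → Node

  infix 4 _⇝_

  -- An occurrence of a ground-type nonterminal is not a node: it stands for the
  -- body of its rule. Nothing is related to it if this never produces a node,
  -- as with the rule F → F.
  data _⇝_ : ∀ {Γ} {b : Body signature Γ} → BodyOcc b → Node → Set where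
    node   : ∀ {Γ} {b : Body signature Γ} {u : BodyOcc b} (k : Kind b) → u ⇝ op u k
    unfold : ∀ {Γ F v} {ss : All (Lam signature Γ) (args (type F))} {u : BodyOcc (nt F ⟨ ss ⟩)} →
             type F ≡ o → body (root F) ⇝ v → u ⇝ v

  -- E i u v: the i-th child of u is v.
  data E : ℕ → Node → Node → Set where
    E-lam : ∀ {Γ A v} {b : Body signature (args A ∷ Γ)} {u : LamOcc (lam {A = A} b)} →
            body u ⇝ v → E 1 (lam u) v
    E-app : ∀ {Γ F} {ss : All (Lam signature Γ) _} {u : BodyOcc (nt F ⟨ ss ⟩)} {a} →
            E 0 (op u (app-node a)) (lam (root F))
    E-arg : ∀ {Γ A B} {h : Head signature Γ A} {ss : All (Lam signature Γ) (args A)}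
            {u : BodyOcc (h ⟨ ss ⟩)} {k} (i : B ∈ args A) →
            E (suc (toℕ (index i))) (op u k) (lam (arg u i))

  Prime : Node → Set
  Prime v = ∃[ u ] E 0 u v

  prefix-ord : List Ty → ℕ
  prefix-ord []       = 0
  prefix-ord (A ∷ As) = suc (maximum (map ord (A ∷ As)))

  -- The order is left undefined on terminal and application nodes; it is only
  -- ever used at lambda nodes and variable nodes.
  node-ord : Node → Maybe ℕ
  node-ord (lam {A = A} _)                = just (prefix-ord (args A))
  node-ord (op _ (variable-node {A = A})) = just (ord A)
  node-ord (op _ terminal-node)           = nothing
  node-ord (op _ (app-node _))            = nothing

  -- Walks up from an occurrence to the lambda whose frame contains x,
  -- counting the edges: x's binder is its ancestor at distance span.
  mutual
    span : ∀ {Γ A} {b : Body signature Γ} → BodyOcc b → Var Γ A → ℕ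
    span (body u) (here _)  = 1
    span (body u) (there x) = suc (span-lam u x)

    span-lam : ∀ {Γ A B} {t : Lam signature Γ B} → LamOcc t → Var Γ A → ℕ
    span-lam (arg u _) x = suc (span u x)

  param : ∀ {Γ A} → Var Γ A → ℕ
  param (here i)  = suc (toℕ (index i))
  param (there x) = param x

  -- The nodes of the computation tree, hence those of its finite unfoldings, are
  -- the finite paths in the graph from the root; the list holds the proper
  -- ancestors, the parent first.
  data Path : Node → List Node → Set where
    start-root : Path (lam (root start)) []
    child      : ∀ {i u v us} → Path u us → E i u v → Path v (u ∷ us)

  -- The first lambda node of order > l among the ancestors is at distance p.
  data FirstAbove (l : ℕ) : List Node → ℕ → Set where
    found    : ∀ {Γ A us} {t : Lam signature Γ A} {u : LamOcc t} →
               l < prefix-ord (args A) → FirstAbove l (lam u ∷ us) 1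
    skip-lam : ∀ {Γ A us p} {t : Lam signature Γ A} {u : LamOcc t} →
               prefix-ord (args A) ≤ l → FirstAbove l us p → FirstAbove l (lam u ∷ us) (suc p)
    skip-op  : ∀ {Γ us p} {b : Body signature Γ} {u : BodyOcc b} {k} →
               FirstAbove l us p → FirstAbove l (op u k ∷ us) (suc p)

  IncrementallyBound : Set
  IncrementallyBound = ∀ {Γ A us} {x : Var Γ A} {ss} {u : BodyOcc (var x ⟨ ss ⟩)} →
    Path (op u variable-node) us → FirstAbove (ord A) us (span u x)

open Graph public using (IncrementallyBound)

------------------------------------------------------------------------
-- Stacks with links

module Stacks (N : Set) where

  -- An order j and a height k; nothing is the irrelevant link, along which
  -- collapse is undefined.
  Link : Set
  Link = Maybe (ℕ × ℕ)

  -- The head of a list is the top of the stack.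
  Stack : ℕ → Set
  Stack zero    = N × Link
  Stack (suc m) = List (Stack m)

  ⊥-stack : ∀ n .{{_ : NonZero n}} → Stack n
  ⊥-stack (suc zero)    = []
  ⊥-stack (suc (suc m)) = ⊥-stack (suc m) ∷ []

  -- Operations that cannot be performed yield nothing.
  top₁ : ∀ n → Stack n → Maybe (N × Link)
  top₁ zero    a       = just a
  top₁ (suc m) []      = nothing
  top₁ (suc m) (s ∷ _) = top₁ m s

  push₁ : ∀ n → N × Link → Stack n → Maybe (Stack n)
  push₁ zero          a s        = nothing
  push₁ (suc zero)    a s        = just (a ∷ s)
  push₁ (suc (suc m)) a []       = nothing
  push₁ (suc (suc m)) a (s ∷ ss) = Maybe.map (_∷ ss) (push₁ (suc m) a s)

  raise-link : ℕ → Link → Link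
  raise-link j nothing         = nothing
  raise-link j (just (j′ , k)) = just (j′ , (if does (j ≟ j′) then suc k else k))

  raise : ℕ → ∀ m → Stack m → Stack m
  raise j zero    (a , ℓ) = a , raise-link j ℓ
  raise j (suc m) s       = map (raise j m) s

  -- push n j is push_j (j ≥ 2) on order-n stacks.
  push : ∀ n → ℕ → Stack n → Maybe (Stack n)
  push zero          j s        = nothing
  push (suc zero)    j s        = nothing
  push (suc (suc m)) j []       = nothing
  push (suc (suc m)) j (s ∷ ss) =
    if does (j ≟ suc (suc m)) then just (raise j (suc m) s ∷ s ∷ ss)
                              else Maybe.map (_∷ ss) (push (suc m) j s)

  pop : ∀ n → ℕ → Stack n → Maybe (Stack n)
  pop zero    j s        = nothing
  pop (suc m) j []       = nothing
  pop (suc m) j (s ∷ ss) =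
    if does (j ≟ suc m) then just ss else Maybe.map (_∷ ss) (pop m j s)

  pops : ∀ n → ℕ → ℕ → Stack n → Maybe (Stack n)
  pops n j zero    s = just s
  pops n j (suc k) s = pop n j s >>= pops n j k

  follow : ∀ n → Link → Stack n → Maybe (Stack n)
  follow n nothing        s = nothing
  follow n (just (j , k)) s = pops n j k s

  collapse : ∀ n → Stack n → Maybe (Stack n)
  collapse n s = top₁ n s >>= λ (_ , ℓ) → follow n ℓ s

------------------------------------------------------------------------
-- The automata

-- A tree is a partial labelling of addresses: t w f says that the node at
-- address w exists and is labelled f. Addresses at which an automaton gets
-- stuck or runs forever without output are outside the domain.
Tree : Set → Set₁
Tree Terminal = List ℕ → Terminal → Set

module Automata (G : Scheme) where
  open Scheme G
  open Graph G
  open Stacks Node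

  n : ℕ
  n = order G

  Operation : Set₁
  Operation = Rel (Stack n) 0ℓ

  ⟦_⟧ : (Stack n → Maybe (Stack n)) → Operation
  ⟦ f ⟧ s s′ = f s ≡ just s′

  Top : Node → Stack n → Set
  Top u s = ∃[ ℓ ] top₁ n s ≡ just (u , ℓ)

  -- push-E i ℓ pushes E_i(top₁), with link ℓ.
  push-E : ℕ → Link → Operation
  push-E i ℓ s s′ = ∃[ u ] ∃[ v ] Top u s × E i u v × push₁ n (v , ℓ) s ≡ just s′

  module Run (collapse-op : Operation) where

    data _⟶_ (s s′ : Stack n) : Set where
      A-step  : ∀ {Γ F} {ss : All (Lam signature Γ) _} {u : BodyOcc (nt F ⟨ ss ⟩)} {a} →
                Top (op u (app-node a)) s →
                push-E 0 (just (1 , 1)) s s′ → s ⟶ s′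
      L-step  : ∀ {Γ A} {t : Lam signature Γ A} {u : LamOcc t} →
                Top (lam u) s →
                push-E 1 nothing s s′ → s ⟶ s′
      V₁-step : ∀ {Γ A} {x : Var Γ A} {ss} {u : BodyOcc (var x ⟨ ss ⟩)} →
                Top (op u variable-node) s → 1 ≤ ord A →
                (⟦ push n (n ∸ ord A + 1) ⟧ ⨾ ⟦ pops n 1 (span u x) ⟧ ⨾ collapse-op ⨾
                 push-E (param x) (just (n ∸ ord A + 1 , 1))) s s′ → s ⟶ s′
      V₀-step : ∀ {Γ A} {x : Var Γ A} {ss} {u : BodyOcc (var x ⟨ ss ⟩)} →
                Top (op u variable-node) s → ord A ≡ 0 →
                (⟦ pops n 1 (span u x) ⟧ ⨾ collapse-op ⨾ push-E (param x) nothing) s s′ → s ⟶ s′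

    data Output (s : Stack n) : Tree Terminal where
      label  : ∀ {Γ f s′} {ss : All (Lam signature Γ) _} {u : BodyOcc (con f ⟨ ss ⟩)} →
               Star _⟶_ s s′ → Top (op u terminal-node) s′ → Output s [] f
      branch : ∀ {Γ f g i w s′ s″} {ss : All (Lam signature Γ) _} {u : BodyOcc (con f ⟨ ss ⟩)} →
               Star _⟶_ s s′ → Top (op u terminal-node) s′ →
               1 ≤ i → i ≤ arity f → push-E i nothing s′ s″ →
               Output s″ w g → Output s (i ∷ w) g

    generated : .{{_ : NonZero n}} → Tree Terminal
    generated w f = ∃[ s ] push₁ n (lam (root start) , nothing) (⊥-stack n) ≡ just s × Output s w f

  -- The replacement for collapse. It never inspects a link, so that with it the
  -- links on the stack play no role.
  data pop-instead (s s′ : Stack n) : Set where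
    prime     : ∀ {u} → Top u s → Prime u → pop n 1 s ≡ just s′ → pop-instead s s′
    non-prime : ∀ {u l} → Top u s → ¬ Prime u → node-ord u ≡ just l →
                pop n (n ∸ l + 1) s ≡ just s′ → pop-instead s s′

  CPDA-tree PDA-tree : .{{_ : NonZero n}} → Tree Terminal
  CPDA-tree = Run.generated ⟦ collapse n ⟧
  PDA-tree  = Run.generated pop-instead

open Automata public using (CPDA-tree; PDA-tree)

{-# OPTIONS --safe #-}

-- The links are redundant on the part of the stack that variables can still
-- reach. Call a lambda node of the top order-1 stack exposed above r if its order
-- exceeds r and the orders of all lambda nodes above it. In an incrementally-bound
-- scheme a variable of order l is bound by the first lambda node exposed above l.
-- The invariant is that a lambda node exposed above r carries a link of height 1,
-- whose order is 1 if the node is prime and n - l + 1 if it is a non-prime node of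
-- order l, and that the same holds again for the stack to which this link leads.
-- The step of a variable of order r raises only links of order n - r + 1, hence of
-- lambda nodes of order r; afterwards only nodes exposed above r are used until
-- the step ends by pushing a lambda node of order r, which hides the raised ones.
module Submission where

open import Data.Bool using (Bool; true; false)
open import Data.Empty using (⊥-elim)
open import Data.Fin using (toℕ)
open import Data.List using (List; []; _∷_; map)
open import Data.List.Membership.Propositional using (_∈_)
open import Data.List.Relation.Unary.All as All using (All)
open import Data.List.Relation.Unary.Any using (here; there; index)
open import Data.Maybe as Maybe using (Maybe; just; nothing)
open import Data.Maybe.Properties using (just-injective)
open import Data.Nat
  using (ℕ; zero; suc; _+_; _∸_; _⊔_; _≤_; _<_; z≤n; s≤s; _≟_; _≤?_; NonZero)
open import Data.Nat.Properties
open import Data.Product using (_×_; _,_; proj₁; proj₂; ∃-syntax)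
open import Data.Product.Properties using (,-injectiveˡ)
open import Data.Sum using (_⊎_; inj₁; inj₂)
open import Function using (_∘_)
open import Function.Bundles using (_⇔_; mk⇔; Equivalence)
open import Relation.Binary.Construct.Closure.ReflexiveTransitive using (Star; ε; _◅_)
open import Relation.Binary.PropositionalEquality
open import Relation.Nullary using (¬_; yes; no; contradiction)
open import Relation.Nullary.Decidable using (dec-true; dec-false)
open import Defs

map≡just : ∀ {A B : Set} {f : A → B} {b} (m : Maybe A) →
           Maybe.map f m ≡ just b → ∃[ a ] m ≡ just a × f a ≡ b
map≡just (just a) refl = a , refl , refl

-- Interaction of pushes, pops and raised links.

module StackProperties (N : Set) where
  open Stacks N

  pop-here : ∀ m (s : Stack m) ss → pop (suc m) (suc m) (s ∷ ss) ≡ just ss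
  pop-here m s ss rewrite dec-true (m ≟ m) refl = refl

  pop-there : ∀ m j (s : Stack m) ss → j ≢ suc m →
              pop (suc m) j (s ∷ ss) ≡ Maybe.map (_∷ ss) (pop m j s)
  pop-there m j s ss j≢ rewrite dec-false (j ≟ suc m) j≢ = refl

  pop-nothing : ∀ m j (s : Stack m) → m < j → pop m j s ≡ nothing
  pop-nothing zero    j s        m<j = refl
  pop-nothing (suc m) j []       m<j = refl
  pop-nothing (suc m) j (s ∷ ss) m<j
    rewrite pop-there m j s ss (≢-sym (<⇒≢ m<j))
          | pop-nothing m j s (<-trans (n<1+n m) m<j) = refl

  -- A pop of order `i` alters only the inside of the top order-(j - 1) stack, which the pop of
  -- order `j` discards; if `j` exceeds `m`, both sides are `nothing`.
  pop-pop : ∀ m {i j} {s t : Stack m} → i < j → pop m i s ≡ just t → pop m j t ≡ pop m j s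
  pop-pop (suc m) {i} {j} {s ∷ ss} i<j eq with i ≟ suc m
  ... | yes refl with trans (sym (pop-here m s ss)) eq
  ... | refl = trans (pop-nothing (suc m) j ss i<j) (sym (pop-nothing (suc m) j (s ∷ ss) i<j))
  pop-pop (suc m) {i} {j} {s ∷ ss} i<j eq | no i≢
    with map≡just (pop m i s) (trans (sym (pop-there m i s ss i≢)) eq)
  ... | t , eq′ , refl with j ≟ suc m
  ... | yes refl = trans (pop-here m t ss) (sym (pop-here m s ss))
  ... | no j≢ = begin
    pop (suc m) j (t ∷ ss)         ≡⟨ pop-there m j t ss j≢ ⟩
    Maybe.map (_∷ ss) (pop m j t)  ≡⟨ cong (Maybe.map (_∷ ss)) (pop-pop m i<j eq′) ⟩
    Maybe.map (_∷ ss) (pop m j s)  ≡⟨ pop-there m j s ss j≢ ⟨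
    pop (suc m) j (s ∷ ss)         ∎
    where open ≡-Reasoning

  pop-pops : ∀ m {j} p {s t : Stack m} → 1 < j → pops m 1 p s ≡ just t → pop m j t ≡ pop m j s
  pop-pops m zero    1<j refl = refl
  pop-pops m (suc p) {s} 1<j eq with pop m 1 s in eq₁
  ... | just s₁ = trans (pop-pops m p 1<j eq) (pop-pop m 1<j eq₁)

  top-push₁ : ∀ m {a} {s t : Stack m} → push₁ m a s ≡ just t → top₁ m t ≡ just a
  top-push₁ (suc zero) refl = refl
  top-push₁ (suc (suc m)) {a} {s ∷ ss} eq with map≡just (push₁ (suc m) a s) eq
  ... | t , eq′ , refl = top-push₁ (suc m) eq′

  pop₁-push₁ : ∀ m {a} {s t : Stack m} → push₁ m a s ≡ just t → pop m 1 t ≡ just s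
  pop₁-push₁ (suc zero) refl = refl
  pop₁-push₁ (suc (suc m)) {a} {s ∷ ss} eq with map≡just (push₁ (suc m) a s) eq
  ... | t , eq′ , refl = cong (Maybe.map (_∷ ss)) (pop₁-push₁ (suc m) eq′)

  pop-push₁ : ∀ m {a j} {s t : Stack m} → 1 < j → push₁ m a s ≡ just t → pop m j t ≡ pop m j s
  pop-push₁ m 1<j eq = sym (pop-pop m 1<j (pop₁-push₁ m eq))

  push-order : ∀ m j {s t : Stack m} → push m j s ≡ just t → 1 < j
  push-order (suc (suc m)) j {s ∷ ss} eq with j ≟ suc (suc m)
  ... | yes refl = s≤s (s≤s z≤n)
  ... | no j≢ rewrite dec-false (j ≟ suc (suc m)) j≢
    with map≡just (push (suc m) j s) eq
  ... | _ , eq′ , _ = push-order (suc m) j eq′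

  pop-push : ∀ m j {s t : Stack m} → push m j s ≡ just t → pop m j t ≡ just s
  pop-push (suc (suc m)) j {s ∷ ss} eq with j ≟ suc (suc m)
  pop-push (suc (suc m)) j {s ∷ ss} eq | yes refl
    rewrite dec-true (m ≟ m) refl with eq
  ... | refl = pop-here (suc m) (map (raise (suc (suc m)) m) s) (s ∷ ss)
  pop-push (suc (suc m)) j {s ∷ ss} eq | no j≢
    rewrite dec-false (j ≟ suc (suc m)) j≢
    with map≡just (push (suc m) j s) eq
  ... | t , eq′ , refl =
    trans (pop-there (suc m) j t ss j≢) (cong (Maybe.map (_∷ ss)) (pop-push (suc m) j eq′))

  -- Only the top order-(j - 1) stacks are compared.
  data Copy (j : ℕ) : ∀ m → Stack m → Stack m → Set where
    here  : ∀ {m s ss ts} → j ≡ suc m → Copy j (suc m) (s ∷ ss) (raise j m s ∷ ts)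
    there : ∀ {m s t ss ts} → j ≤ m → Copy j m s t → Copy j (suc m) (s ∷ ss) (t ∷ ts)

  push-bound : ∀ m j {s t : Stack m} → push m j s ≡ just t → j ≤ m
  push-bound (suc (suc m)) j {s ∷ ss} eq with j ≟ suc (suc m)
  ... | yes refl = ≤-refl
  ... | no j≢ rewrite dec-false (j ≟ suc (suc m)) j≢
    with map≡just (push (suc m) j s) eq
  ... | _ , eq′ , _ = m≤n⇒m≤1+n (push-bound (suc m) j eq′)

  push-copy : ∀ m j {s t : Stack m} → push m j s ≡ just t → Copy j m s t
  push-copy (suc (suc m)) j {s ∷ ss} eq with j ≟ suc (suc m)
  push-copy (suc (suc m)) j {s ∷ ss} eq | yes refl
    rewrite dec-true (m ≟ m) refl with eq
  ... | refl = here refl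
  push-copy (suc (suc m)) j {s ∷ ss} eq | no j≢
    rewrite dec-false (j ≟ suc (suc m)) j≢
    with map≡just (push (suc m) j s) eq
  ... | t , eq′ , refl = there (push-bound (suc m) j eq′) (push-copy (suc m) j eq′)

  raise-pop : ∀ j m {i} {s t : Stack m} → pop m i s ≡ just t →
              pop m i (raise j m s) ≡ just (raise j m t)
  raise-pop j (suc m) {i} {s ∷ ss} eq with i ≟ suc m
  ... | yes refl with trans (sym (pop-here m s ss)) eq
  ... | refl = pop-here m _ _
  raise-pop j (suc m) {i} {s ∷ ss} eq | no i≢
    with map≡just (pop m i s) (trans (sym (pop-there m i s ss i≢)) eq)
  ... | t , eq′ , refl = trans (pop-there m i _ _ i≢) (cong (Maybe.map _) (raise-pop j m eq′))

  -- As `i < j`, the pop acts inside the top order-(j - 1) stacks, which agree up to raised links.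
  copy-pop : ∀ {j} m {i} {s s′ t : Stack m} → Copy j m s t → i < j → pop m i s ≡ just s′ →
             ∃[ t′ ] pop m i t ≡ just t′ × Copy j m s′ t′
  copy-pop (suc m) {i} (here {s = s} {ss} {ts} refl) i<j eq
    with map≡just (pop m i s) (trans (sym (pop-there m i s ss (<⇒≢ i<j))) eq)
  ... | s′ , eq′ , refl = raise _ m s′ ∷ ts ,
    trans (pop-there m i _ _ (<⇒≢ i<j)) (cong (Maybe.map _) (raise-pop _ m eq′)) , here refl
  copy-pop (suc m) {i} (there {s = s} {t} {ss} {ts} j≤m c) i<j eq
    with map≡just (pop m i s) (trans (sym (pop-there m i s ss i≢)) eq)
    where i≢ = <⇒≢ (<-≤-trans i<j (m≤n⇒m≤1+n j≤m))
  ... | s′ , eq′ , refl with copy-pop m c i<j eq′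
  ... | t′ , eq″ , c′ = t′ ∷ ts ,
    trans (pop-there m i t ts (<⇒≢ (<-≤-trans i<j (m≤n⇒m≤1+n j≤m)))) (cong (Maybe.map _) eq″) ,
    there j≤m c′

  raise-top : ∀ j m {a ℓ} {s : Stack m} → top₁ m s ≡ just (a , ℓ) →
              top₁ m (raise j m s) ≡ just (a , raise-link j ℓ)
  raise-top j zero    refl = refl
  raise-top j (suc m) {s = s ∷ ss} eq = raise-top j m eq

  copy-top : ∀ {j} m {a ℓ} {s t : Stack m} → Copy j m s t → top₁ m s ≡ just (a , ℓ) →
             top₁ m t ≡ just (a , raise-link j ℓ)
  copy-top (suc m) (here _)    eq = raise-top _ m eq
  copy-top (suc m) (there _ c) eq = copy-top m c eq

  raise-link-other : ∀ {j i k} → i ≢ j → raise-link j (just (i , k)) ≡ just (i , k)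
  raise-link-other {j} {i} i≢j rewrite dec-false (j ≟ i) (≢-sym i≢j) = refl

module Equivalent (G : Scheme) where
  open Scheme G
  open Graph G
  open Stacks Node
  open StackProperties Node
  open Automata G hiding (CPDA-tree; PDA-tree)

  -- Orders, operands and primality of nodes.

  prefix-ord-args : ∀ A → prefix-ord (args A) ≡ ord A
  prefix-ord-args o = refl
  prefix-ord-args (A ⇒ o) = cong suc (⊔-identityʳ (ord A))
  prefix-ord-args (A ⇒ B@(_ ⇒ _)) = cong (suc (ord A) ⊔_) (prefix-ord-args B)

  params : Node → List Ty
  params (lam {A = A} _) = args A
  params (op _ _)        = []

  operandTypes : Node → List Ty
  operandTypes (lam _)                      = []
  operandTypes (op {b = _⟨_⟩ {A} _ _} _ _) = args A

  -- Operation nodes get order 0, so that they hide nothing.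
  lam-ord : Node → ℕ
  lam-ord = prefix-ord ∘ params

  -- Separates `root` from `arg` by computation, so that primality of an operand can be refuted
  -- without unifying the indices of the two constructors.
  is-root : ∀ {Γ A} {t : Lam signature Γ A} → LamOcc t → Bool
  is-root (root _)  = true
  is-root (arg _ _) = false

  is-root-node : Node → Bool
  is-root-node (lam u)  = is-root u
  is-root-node (op _ _) = false

  prime-root : ∀ {v} → Prime v → is-root-node v ≡ true
  prime-root (_ , E-app) = refl

  ∈-position : ∀ {A B} {As : List Ty} (i : A ∈ As) (i′ : B ∈ As) → toℕ (index i) ≡ toℕ (index i′) → A ≡ B
  ∈-position (here refl) (here refl) _  = refl
  ∈-position (there i)   (there i′)  eq = ∈-position i i′ (suc-injective eq)

  -- A lambda node has no operand types and the edge to a prime node has number 0, so only `E-arg`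
  -- remains; its position determines the type.
  operand : ∀ {A As w v k} (i : A ∈ As) → operandTypes w ≡ As → k ≡ suc (toℕ (index i)) →
            E k w v → params v ≡ args A × ¬ Prime v
  operand () refl _ (E-lam _)
  operand i refl () E-app
  operand i refl eq (E-arg i′) =
    cong args (∈-position i′ i (suc-injective eq)) , λ p → contradiction (prime-root p) λ ()

  ⇝-params : ∀ {Γ v} {b : Body signature Γ} {u : BodyOcc b} → u ⇝ v → params v ≡ []
  ⇝-params (node _)     = refl
  ⇝-params (unfold _ r) = ⇝-params r

  ⇝-not-lam : ∀ {Γ Γ′ A} {b : Body signature Γ} {u : BodyOcc b} {t : Lam signature Γ′ A}
              {v : LamOcc t} → ¬ (u ⇝ lam v)
  ⇝-not-lam (unfold _ r) = ⇝-not-lam r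

  -- The binder of a variable along a path.

  data At : List Node → ℕ → Node → Set where
    here  : ∀ {v us} → At (v ∷ us) 1 v
    there : ∀ {u v us p} → At us p v → At (u ∷ us) (suc p) v

  no-params : ∀ {A B} → B ≡ o → ¬ (A ∈ args B)
  no-params refl ()

  -- A ground-type nonterminal has no parameters, so the rule body to which unfolding leads is
  -- closed.
  unfolded-closed : ∀ {Γ Γ′ A v} {b : Body signature Γ} {b′ : Body signature Γ′}
                    {u : BodyOcc b} {u′ : BodyOcc b′} {k} →
                    (∀ {A} → ¬ Var Γ A) → u ⇝ v → v ≡ op u′ k → ¬ Var Γ′ A
  unfolded-closed closed (node _)      refl x = closed x
  unfolded-closed closed (unfold eq r) v≡   x =
    unfolded-closed (λ { (here i) → no-params eq i }) r v≡ x

  BinderAt : List Node → ℕ → Ty → ℕ → Set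
  BinderAt us p A q = ∃[ v ] At us p v × ∃[ i ] q ≡ suc (toℕ (index {P = A ≡_} {xs = params v} i))

  mutual
    -- The path retraces the occurrence that `span` climbs. Before reaching the binder it could
    -- depart from it only at an unfolding, below which no variable is in scope.
    binder : ∀ {Γ A us} {b : Body signature Γ} {u : BodyOcc b} {k} →
             Path (op u k) us → (x : Var Γ A) → BinderAt us (span u x) A (param x)
    binder (child _ (E-lam (node _))) (here i) = _ , here , i , refl
    binder (child π (E-lam (node _))) (there x) with binder-lam π x
    ... | v , at , i , eq = v , there at , i , eq
    binder (child _ (E-lam (unfold eq r))) x = ⊥-elim (unfolded-closed (λ { (here i) → no-params eq i }) r refl x)

    binder-lam : ∀ {Γ A B us} {t : Lam signature Γ B} {u : LamOcc t} →
                 Path (lam u) us → (x : Var Γ A) → BinderAt us (span-lam u x) A (param x)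
    binder-lam (child π (E-lam r)) x = ⊥-elim (⇝-not-lam r)
    binder-lam (child π (E-arg i)) x with binder π x
    ... | v , at , i , eq = v , there at , i , eq

  -- The invariant on linked stacks.

  LinkOrder : Node → ℕ → Set
  LinkOrder w j = (Prime w × j ≡ 1) ⊎ (¬ Prime w × j ≡ n ∸ lam-ord w + 1)

  -- Good r us s: us are the nodes of the top order-1 stack of s, and the lambda
  -- nodes exposed above r are linked as required.
  mutual
    data Good (r : ℕ) : List Node → Stack n → Set where
      []      : ∀ {s} → Good r [] s
      hidden  : ∀ {w us s s′ ℓ} → lam-ord w ≤ r → top₁ n s ≡ just (w , ℓ) →
                pop n 1 s ≡ just s′ → Good r us s′ → Good r (w ∷ us) s
      exposed : ∀ {w us s s′} → Linked r w s →
                pop n 1 s ≡ just s′ → Good (lam-ord w) us s′ → Good r (w ∷ us) s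

    -- `caller` is the node whose operands are bound to the parameters of `w`. Its stack keeps the
    -- bound `r`, not `lam-ord w`: a variable of order `r` pushes a node of order `r` onto it,
    -- beneath which everything exposed above `r` stays reachable.
    record Linked (r : ℕ) (w : Node) (s : Stack n) : Set where
      inductive
      constructor linked
      field
        {level}     : ℕ
        {target}    : Stack n
        {caller}    : Node
        {ancestors} : List Node
        above       : r < lam-ord w
        link        : top₁ n s ≡ just (w , just (level , 1))
        link-order  : LinkOrder w level
        pop-target  : pop n level s ≡ just target
        path        : Path caller ancestors
        operands    : operandTypes caller ≡ params w
        good        : Good r (caller ∷ ancestors) target

  good-top : ∀ {r w v us s} → Good r (w ∷ us) s → Top v s → w ≡ v
  good-top (hidden _ top _ _)  (_ , eq) = ,-injectiveˡ (just-injective (trans (sym top) eq))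
  good-top (exposed L _ _) (_ , eq) =
    ,-injectiveˡ (just-injective (trans (sym (Linked.link L)) eq))

  mutual
    -- A larger bound may turn an exposed node into a hidden one; the nodes below it then pass from
    -- the bound `lam-ord w` to `r′`.
    good-mono : ∀ {r r′ us s} → r ≤ r′ → Good r us s → Good r′ us s
    good-mono r≤r′ [] = []
    good-mono r≤r′ (hidden l≤r top eq g) = hidden (≤-trans l≤r r≤r′) top eq (good-mono r≤r′ g)
    good-mono {r′ = r′} r≤r′ (exposed {w} (linked _ link lo pt π ops g′) eq g) with lam-ord w ≤? r′
    ... | yes l≤r′ = hidden l≤r′ link eq (good-mono l≤r′ g)
    ... | no  l≰r′ = exposed (linked (≰⇒> l≰r′) link lo pt π ops (good-mono r≤r′ g′)) eq g

  link-order-< : ∀ {j r w i} → 1 < j → (∀ {l} → r < l → n ∸ l + 1 < j) → r < lam-ord w →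
                 LinkOrder w i → i < j
  link-order-< 1<j below r<l (inj₁ (_ , refl)) = 1<j
  link-order-< 1<j below r<l (inj₂ (_ , refl)) = below r<l

  -- Links of nodes exposed above `r` have order less than `j`, so they are not raised and following
  -- them stays inside the copy. Raised links sit on hidden nodes, where `Good` constrains no link.
  good-copy : ∀ {j r us s t} → 1 < j → (∀ {l} → r < l → n ∸ l + 1 < j) → Copy j n s t →
              Good r us s → Good r us t
  good-copy 1<j below c [] = []
  good-copy 1<j below c (hidden l≤r top eq g) with copy-pop n c 1<j eq
  ... | t′ , eq′ , c′ = hidden l≤r (copy-top n c top) eq′ (good-copy 1<j below c′ g)
  good-copy 1<j below c (exposed {w} (linked {i} r<l link lo pt π ops g′) eq g)
    with copy-pop n c 1<j eq | copy-pop n c (link-order-< {w = w} 1<j below r<l lo) pt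
  ... | t′ , eq′ , c′ | t″ , eq″ , c″ =
    exposed (linked r<l
               (trans (copy-top n c link)
                      (cong (λ ℓ → just (w , ℓ))
                            (raise-link-other (<⇒≢ (link-order-< {w = w} 1<j below r<l lo)))))
               lo eq″ π ops (good-copy 1<j below c″ g′))
            eq′ (good-copy 1<j (λ l<l′ → below (<-trans r<l l<l′)) c′ g)

  pops-suc : ∀ {s s′} p → pop n 1 s ≡ just s′ → pops n 1 (suc p) s ≡ pops n 1 p s′
  pops-suc p eq rewrite eq = refl

  -- `FirstAbove` skips exactly nodes that `Good` must hide and stops at one that it must expose.
  -- The list `us` starts at the parent, hence one pop precedes it.
  walk : ∀ {r us p v s s′} → FirstAbove r us p → At us p v →
         pop n 1 s ≡ just s′ → Good r us s′ → ∃[ t ] pops n 1 p s ≡ just t × Linked r v t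
  walk (found r<l) here eq (hidden l≤r _ _ _) = contradiction l≤r (<⇒≱ r<l)
  walk (found r<l) here eq (exposed L _ _)    = _ , pops-suc 0 eq , L
  walk (skip-lam l≤r f) (there at) eq (exposed L _ _) = contradiction l≤r (<⇒≱ (Linked.above L))
  walk (skip-lam l≤r f) (there {p = p} at) eq (hidden _ _ eq′ g) with walk f at eq′ g
  ... | t , eq″ , L = t , trans (pops-suc p eq) eq″ , L
  -- An operation node has `lam-ord` 0, which exceeds no bound.
  walk (skip-op f) (there at) eq (exposed L _ _) = contradiction (Linked.above L) λ ()
  walk (skip-op f) (there {p = p} at) eq (hidden _ _ eq′ g) with walk f at eq′ g
  ... | t , eq″ , L = t , trans (pops-suc p eq) eq″ , L

  -- Collapse and its replacement at linked nodes.

  -- The simulation uses one direction to identify the result of the first automaton and the other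
  -- to perform the step in the second.
  Faithful : Operation → Set
  Faithful C = ∀ {r w s} (L : Linked r w s) s′ → C s s′ ⇔ s′ ≡ Linked.target L

  collapse-linked : ∀ {r w s} (L : Linked r w s) → collapse n s ≡ just (Linked.target L)
  collapse-linked {s = s} L
    rewrite Linked.link L | Linked.pop-target L = refl

  collapse-faithful : Faithful ⟦ collapse n ⟧
  collapse-faithful L s′ = mk⇔
    (λ eq → just-injective (trans (sym eq) (collapse-linked L)))
    (λ { refl → collapse-linked L })

  top-unique : ∀ {s u v ℓ} → top₁ n s ≡ just (u , ℓ) → Top v s → u ≡ v
  top-unique eq (_ , eq′) = ,-injectiveˡ (just-injective (trans (sym eq) eq′))

  pop-instead-complete : ∀ {r w s} (L : Linked r w s) → pop-instead s (Linked.target L)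
  pop-instead-complete (linked _ link (inj₁ (p , refl)) pt _ _ _) = prime (_ , link) p pt
  -- Matching on `lam _` makes `node-ord` compute to `lam-ord`; an operation node would contradict
  -- `above`.
  pop-instead-complete {w = lam _} (linked _ link (inj₂ (¬p , refl)) pt _ _ _) =
    non-prime (_ , link) ¬p refl pt

  pop-instead-sound : ∀ {r w s s′} (L : Linked r w s) → pop-instead s s′ → s′ ≡ Linked.target L
  pop-instead-sound L (prime top p eq) with top-unique (Linked.link L) top
  pop-instead-sound (linked _ _ (inj₁ (_ , refl)) pt _ _ _) (prime _ _ eq) | refl =
    just-injective (trans (sym eq) pt)
  pop-instead-sound (linked _ _ (inj₂ (¬p , _)) _ _ _ _) (prime _ p _) | refl = contradiction p ¬p
  pop-instead-sound L (non-prime top ¬p l eq) with top-unique (Linked.link L) top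
  pop-instead-sound (linked _ _ (inj₁ (p , _)) _ _ _ _) (non-prime _ ¬p _ _) | refl =
    contradiction p ¬p
  pop-instead-sound {w = lam _} (linked _ _ (inj₂ (_ , refl)) pt _ _ _) (non-prime _ _ refl eq) | refl =
    just-injective (trans (sym eq) pt)

  pop-instead-faithful : Faithful pop-instead
  pop-instead-faithful L s′ = mk⇔ (pop-instead-sound L) λ { refl → pop-instead-complete L }

  Invariant : Stack n → Set
  Invariant s = ∃[ w ] ∃[ us ] Path w us × Good 0 (w ∷ us) s

  -- A node of order 0 is hidden at bound 0, and `hidden` asks nothing of its link.
  invariant-push : ∀ {i w v us s s′ ℓ} → lam-ord v ≡ 0 → Path w us → Good 0 (w ∷ us) s →
                   E i w v → push₁ n (v , ℓ) s ≡ just s′ → Invariant s′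
  invariant-push l≡0 π g e eq =
    _ , _ , child π e , hidden (≤-reflexive l≡0) (top-push₁ n eq) (pop₁-push₁ n eq) g

  lam-ord-params : ∀ {w A} → params w ≡ args A → lam-ord w ≡ ord A
  lam-ord-params {A = A} eq = trans (cong prefix-ord eq) (prefix-ord-args A)

  -- If `l` exceeds `m`, truncation makes the left side 1, and strictness comes from the first
  -- hypothesis.
  m∸l+1<m∸k+1 : ∀ {m k l} → 1 < m ∸ k + 1 → k < l → m ∸ l + 1 < m ∸ k + 1
  m∸l+1<m∸k+1 {m} {k} {l} 1<j k<l with l ≤? m
  ... | yes l≤m = +-monoˡ-< 1 (∸-monoʳ-< k<l l≤m)
  ... | no  l≰m rewrite m≤n⇒m∸n≡0 (<⇒≤ (≰⇒> l≰m)) = 1<j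

  -- Simulation between automata with faithful operations.

  module Transfer (ib : Graph.IncrementallyBound G) {C D : Operation}
                  (C-faithful : Faithful C) (D-faithful : Faithful D) where
    private
      module C = Run C
      module D = Run D

    -- The part common to both variable rules; for order at least 1, `s` is the stack after the
    -- initial push. `pop-unaffected` serves to find where the new link leads.
    record VariableStep (A : Ty) (q : ℕ) (ℓ : Link) (s t t′ s′ : Stack n) : Set where
      field
        collapse-D     : D t t′
        {pushed}       : Node
        {caller}       : Node
        {ancestors}    : List Node
        path           : Path caller ancestors
        edge           : E q caller pushed
        good           : Good (ord A) (caller ∷ ancestors) t′
        pushed-params  : params pushed ≡ args A
        pushed-¬prime  : ¬ Prime pushed
        pushed-onto    : push₁ n (pushed , ℓ) t′ ≡ just s′
        pop-unaffected : ∀ {j} → 1 < j → (∀ {l} → ord A < l → n ∸ l + 1 < j) →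
                         pop n j s′ ≡ pop n j s

    variable-step :
      ∀ {Γ A} {x : Var Γ A} {ss} {u : BodyOcc (var x ⟨ ss ⟩)} {us s t t′ s′ ℓ} →
      Path (op u variable-node) us → Good (ord A) (op u variable-node ∷ us) s →
      pops n 1 (span u x) s ≡ just t → C t t′ → push-E (param x) ℓ t′ s′ →
      VariableStep A (param x) ℓ s t t′ s′
    variable-step π (exposed L _ _) eq c pu = contradiction (Linked.above L) λ ()
    variable-step {x = x} {u = u} π (hidden _ _ eq₁ g) eq c (w , v , top , e , eq′)
      with binder π x
    -- Incremental binding: the binder, at distance `span`, is the first lambda node of order above
    -- that of the variable, so `walk` makes it linked.
    ... | b , at , i , q≡ with walk (ib π) at eq₁ g
    ... | t , eq″ , L with just-injective (trans (sym eq) eq″)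
    ... | refl with Equivalence.to (C-faithful L _) c
    ... | refl with good-top (Linked.good L) top
    ... | refl = record
      { collapse-D     = Equivalence.from (D-faithful L _) refl
      ; path           = Linked.path L
      ; edge           = e
      ; good           = Linked.good L
      ; pushed-params  = proj₁ (operand i (Linked.operands L) q≡ e)
      ; pushed-¬prime  = proj₂ (operand i (Linked.operands L) q≡ e)
      ; pushed-onto    = eq′
      ; pop-unaffected = λ 1<j below →
          trans (pop-push₁ n 1<j eq′)
            (trans (pop-pop n (link-order-< {w = b} 1<j below (Linked.above L) (Linked.link-order L))
                              (Linked.pop-target L))
                   (pop-pops n (span u x) 1<j eq))
      }

    first-order-args : ∀ {A} k → A ∈ args (first-order k) → A ≡ o
    first-order-args (suc k) (here refl) = refl
    first-order-args (suc k) (there i)   = first-order-args k i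

    terminal-operand : ∀ {Γ f i v} {ss : All (Lam signature Γ) _} {u : BodyOcc (con f ⟨ ss ⟩)} →
                       E i (op u terminal-node) v → lam-ord v ≡ 0
    terminal-operand {f = f} (E-arg i) = cong (prefix-ord ∘ args) (first-order-args (arity f) i)

    lambda-child : ∀ {i v Γ A} {t : Lam signature Γ A} {u : LamOcc t} → E i (lam u) v → lam-ord v ≡ 0
    lambda-child (E-lam r) = cong prefix-ord (⇝-params r)

    step : ∀ {s s′} → Invariant s → s C.⟶ s′ → s D.⟶ s′ × Invariant s′
    step (w , us , π , g) (C.A-step top (w′ , v , top′ , e@E-app , eq)) with good-top g top′
    ... | refl = D.A-step top (w′ , v , top′ , e , eq) , _ , _ , child π e , good′
      where
      good′ : Good 0 (v ∷ w ∷ us) _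
      good′ with lam-ord v ≤? 0
      ... | yes l≤0 = hidden l≤0 (top-push₁ n eq) (pop₁-push₁ n eq) g
      -- The link of order and height 1 returns to the application node just left, whose operand
      -- types are the parameter types of the pushed prime node.
      ... | no  l≰0 = exposed (linked (≰⇒> l≰0) (top-push₁ n eq) (inj₁ ((w , e) , refl))
                                      (pop₁-push₁ n eq) π refl g)
                              (pop₁-push₁ n eq) (good-mono z≤n g)
    step (w , us , π , g) (C.L-step top pu@(_ , _ , top′ , e , eq))
      with good-top g top | good-top g top′
    ... | refl | refl = D.L-step top pu , invariant-push (lambda-child e) π g e eq
    step (w , us , π , g) (C.V₁-step {A = A} {x} {u = u} top 1≤l (s₁ , eq₁ , s₂ , eq₂ , s₃ , c , pu))
      with good-top g top
    ... | refl = D.V₁-step top 1≤l (s₁ , eq₁ , s₂ , eq₂ , s₃ , V.collapse-D , pu) ,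
                 _ , _ , child V.path V.edge ,
                 exposed (linked (subst (0 <_) (sym l≡) 1≤l) (top-push₁ n V.pushed-onto)
                                 (inj₂ (V.pushed-¬prime , cong (λ l → n ∸ l + 1) (sym l≡)))
                                 -- Walking, following the binder's link and pushing all act below
                                 -- order `j`, so the pop undoes the initial push: the new link
                                 -- leads to the stack before the step, whose top, the variable
                                 -- node, is the caller.
                                 (trans (V.pop-unaffected 1<j below) (pop-push n _ eq₁))
                                 π (sym V.pushed-params) g)
                         (pop₁-push₁ n V.pushed-onto)
                         (subst (λ l → Good l (V.caller ∷ V.ancestors) s₃) (sym l≡) V.good)
      where
      1<j : 1 < n ∸ ord A + 1
      -- The push was performed, so its order is at least 2, that is, `ord A < n`.
      1<j = push-order n _ eq₁
      below : ∀ {l} → ord A < l → n ∸ l + 1 < n ∸ ord A + 1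
      below = m∸l+1<m∸k+1 1<j
      module V = VariableStep
        (variable-step {x = x} {u = u} π
          -- The bound first grows from 0 to `ord A`, so that no constrained link has the order that
          -- the push raises.
          (good-copy 1<j below (push-copy n _ eq₁) (good-mono z≤n g)) eq₂ c pu)
      l≡ : lam-ord V.pushed ≡ ord A
      l≡ = lam-ord-params {V.pushed} V.pushed-params
    step (w , us , π , g) (C.V₀-step {A = A} {x} {u = u} top l≡0 (s₂ , eq₂ , s₃ , c , pu))
      with good-top g top
    ... | refl = D.V₀-step top l≡0 (s₂ , eq₂ , s₃ , V.collapse-D , pu) ,
                 invariant-push (trans (lam-ord-params {V.pushed} V.pushed-params) l≡0) V.path
                   (subst (λ l → Good l (V.caller ∷ V.ancestors) s₃) l≡0 V.good) V.edge V.pushed-onto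
      where
      module V = VariableStep (variable-step {x = x} {u = u} π (good-mono z≤n g) eq₂ c pu)

    steps : ∀ {s s′} → Invariant s → Star C._⟶_ s s′ → Star D._⟶_ s s′ × Invariant s′
    steps inv ε = ε , inv
    steps inv (r ◅ rs) with step inv r
    ... | r′ , inv′ with steps inv′ rs
    ... | rs′ , inv″ = r′ ◅ rs′ , inv″

    output : ∀ {s w f} → Invariant s → C.Output s w f → D.Output s w f
    output inv (C.label rs top) = D.label (proj₁ (steps inv rs)) top
    output inv (C.branch rs top 1≤i i≤k pu@(_ , _ , top′ , e , eq) out) with steps inv rs
    ... | rs′ , w , us , π , g with good-top g top | good-top g top′
    ... | refl | refl = D.branch rs′ top 1≤i i≤k pu
                          (output (invariant-push (terminal-operand e) π g e eq) out)

    generated : .{{_ : NonZero n}} → ∀ {w f} → C.generated w f → D.generated w f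
    generated (s , eq , out) = s , eq , output initial out
      where
      initial : Invariant s
      initial = _ , _ , start-root ,
        -- The start symbol is ground, so the root is a dummy lambda of order 0.
        hidden (≤-reflexive (cong (prefix-ord ∘ args) start-ground))
               (top-push₁ n eq) (pop₁-push₁ n eq) []

theorem4p1 : (G : Scheme) .{{_ : NonZero (order G)}} → IncrementallyBound G →
    ∀ w f → CPDA-tree G w f ⇔ PDA-tree G w f
theorem4p1 G ib w f = mk⇔
  -- The transfer treats any two faithful operations alike, so exchanging them gives the converse
  -- inclusion.
  (Transfer.generated ib collapse-faithful pop-instead-faithful)
  (Transfer.generated ib pop-instead-faithful collapse-faithful)
  where open Equivalent G
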